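{- Let $G^v$ be the simple undirected graph with vertex set $\{a,b,c,d,e,x,y,z\}$ and edge set $$\{ab,\ ac,\ bc,\ bd,\ bx,\ by,\ ce,\ cx,\ cy,\ dy,\ ex,\ xz,\ yz\}.$$ Then $G^v$ is perfect but not box-perfect, and none of its induced subgraphs belongs to $\mathcal{R}$.
   Context: A clique of a graph is a set of pairwise adjacent vertices. A graph is perfect if each of its induced subgraphs has chromatic number equal to its clique number; equivalently, the convex hull of the incidence vectors of its stable sets (sets of pairwise nonadjacent vertices) is described by the system $$x(C)\le 1 \text{ for all cliques } C,\qquad x\ge \mathbf{0},$$ where $x(C)=\sum_{v\in C}x_v$. A graph is box-perfect if this system is box-TDI. A rational linear system $Ax\le b$ is totally dual integral (TDI) if for every integer vector $w$ for which the optimum in $\max\{w^\top x:Ax\le b\}=\min\{b^\top y: A^\top y=w,\ y\ge \mathbf{0}\}$ is finite, the minimum is attained by an integer vector $y$. The system $Ax\le b$ is box-TDI if the system $Ax\le b,\ \ell\le x\le u$ is TDI for all rational vectors $\ell,u$. The class $\mathcal{R}$ (graphs up to isomorphism) consists of the graphs built as follows. Let $K=(U,V,E)$ be a bipartite graph with colour classes $U,V$ whose biadjacency matrix (the $0/1$ matrix with rows indexed by $U$ and columns by $V$) is minimally non-totally-unimodular, that is, it is not totally unimodular but every proper submatrix of it is (a matrix is totally unimodular if all its square submatrices have determinant in $\{ -1,0,1\}$). Add a set $F$ of edges between vertices of $V$ such that, in $K'=(U\cup V,E\cup F)$, the neighborhood $N_{K'}(u)$ is a clique for every $u\in U$. If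 there exists $u\in U$ with $N_{K'}(u)=V$, then $K'\setminus\{u\}$ is in $\mathcal{R}$; otherwise $K'$ is in $\mathcal{R}$. -}

module Defs where

open import Data.Bool using (Bool; true; false; T; _∨_; if_then_else_)
open import Data.Bool.Properties using (∨-comm) renaming (_≟_ to _≟ᵇ_)
open import Data.Nat using (ℕ; zero; suc; _+_; _≤_)
open import Data.Integer as ℤ using (ℤ; 0ℤ; 1ℤ; -1ℤ)
import Data.Integer.Properties as ℤₚ
open import Data.Rational as ℚ using (ℚ; 0ℚ; 1ℚ)
import Data.Rational.Properties as ℚₚ
open import Data.Rational.Literals using (fromℤ)
open import Data.Fin using (Fin; zero; suc; toℕ; cast; punchIn; splitAt; _↑ˡ_; #_)
open import Data.Fin.Properties using (_≟_; all?)
open import Data.Fin.Subset using (Subset; inside; outside; ⊥; ⊤; ⁅_⁆; ∁; _∈_; ∣_∣)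
open import Data.Fin.Subset.Properties using (_∈?_)
open import Data.List using (List; []; _∷_; map; filter; length; _++_)
import Data.List.Membership.DecPropositional as ListMembership
open import Data.Vec using (Vec; []; _∷_; lookup; tabulate) renaming (_++_ to _++ⱽ_)
open import Data.Vec.Functional as VF using (Vector)
open import Data.Product using (_×_; _,_; ∃; ∃-syntax)
open import Data.Product.Properties using (≡-dec)
open import Data.Sum using (_⊎_; inj₁; inj₂)
open import Function using (_∘_; _↔_; Inverse)
open import Relation.Nullary using (¬_; Dec; does)
open import Relation.Nullary.Decidable using (_→-dec_; ¬?; T?; from-yes)
open import Relation.Binary.PropositionalEquality using (_≡_; _≢_; refl)
import Algebra.Properties.CommutativeMonoid.Sum as Sum

private
  variable
    m n k l : ℕ

∑ℤ : Vector ℤ n → ℤ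
∑ℤ = Sum.sum ℤₚ.+-0-commutativeMonoid

∑ℚ : Vector ℚ n → ℚ
∑ℚ = Sum.sum ℚₚ.+-0-commutativeMonoid

------------------------------------------------------------------------
-- Subsets

-- The increasing enumeration of the elements of S.
elements : (S : Subset n) → Fin ∣ S ∣ → Fin n
elements (inside  ∷ S) zero    = zero
elements (inside  ∷ S) (suc i) = suc (elements S i)
elements (outside ∷ S) i       = suc (elements S i)

subsets : ∀ n → List (Subset n)
subsets zero    = [] ∷ []
subsets (suc n) = map (outside ∷_) (subsets n) ++ map (inside ∷_) (subsets n)

------------------------------------------------------------------------
-- Finite simple graphs

record Graph (n : ℕ) : Set where
  field
    adj    : Fin n → Fin n → Bool
    sym    : ∀ i j → adj i j ≡ adj j i
    irrefl : ∀ i → adj i i ≡ false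

  Adj : Fin n → Fin n → Set
  Adj i j = T (adj i j)

  neighbourhood : Fin n → Subset n
  neighbourhood i = tabulate (adj i)

  IsClique : Subset n → Set
  IsClique C = ∀ i j → i ∈ C → j ∈ C → i ≢ j → Adj i j

  isClique? : ∀ C → Dec (IsClique C)
  isClique? C = all? λ i → all? λ j →
    (i ∈? C) →-dec ((j ∈? C) →-dec (¬? (i ≟ j) →-dec T? (adj i j)))

  Colourable : ℕ → Set
  Colourable k = ∃ λ (c : Fin n → Fin k) → ∀ i j → Adj i j → c i ≢ c j

  IsChromaticNumber : ℕ → Set
  IsChromaticNumber k = Colourable k × (∀ j → Colourable j → k ≤ j)

  IsCliqueNumber : ℕ → Set
  IsCliqueNumber k =
    (∃ λ C → IsClique C × ∣ C ∣ ≡ k) × (∀ C → IsClique C → ∣ C ∣ ≤ k)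

open Graph public

infix 8 _[_]
infix 4 _≅_

-- The subgraph induced by S, its vertices renumbered in increasing order.
_[_] : Graph n → (S : Subset n) → Graph ∣ S ∣
G [ S ] = record
  { adj    = λ i j → adj G (elements S i) (elements S j)
  ; sym    = λ i j → sym G (elements S i) (elements S j)
  ; irrefl = λ i → irrefl G (elements S i)
  }

record _≅_ (G : Graph m) (H : Graph n) : Set where
  field
    bijection    : Fin m ↔ Fin n
    adj-preserve : ∀ i j →
      adj G i j ≡ adj H (Inverse.to bijection i) (Inverse.to bijection j)

Perfect : Graph n → Set
Perfect {n} G = ∀ (S : Subset n) →
  ∃[ k ] (IsChromaticNumber (G [ S ]) k × IsCliqueNumber (G [ S ]) k)

------------------------------------------------------------------------
-- Linear systems A x ≤ b with rational data

infix 7 _·_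

_·_ : Vector ℚ n → Vector ℚ n → ℚ
x · y = ∑ℚ λ i → x i ℚ.* y i

_≤ᵛ_ : Vector ℚ n → Vector ℚ n → Set
x ≤ᵛ y = ∀ i → x i ℚ.≤ y i

-- n is the number of variables.
record LinearSystem (n : ℕ) : Set where
  field
    rows : ℕ
    A    : Vector (Vector ℚ n) rows
    b    : Vector ℚ rows

  Feasible : Vector ℚ n → Set
  Feasible x = (λ i → A i · x) ≤ᵛ b

  -- Aᵀ y = w and y ≥ 0.
  DualFeasible : Vector ℚ n → Vector ℚ rows → Set
  DualFeasible w y =
    (∀ j → (λ i → A i j) · y ≡ w j) × (∀ i → 0ℚ ℚ.≤ y i)

  IsMax : Vector ℚ n → ℚ → Set
  IsMax w v = (∃ λ x → Feasible x × w · x ≡ v)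
            × (∀ x → Feasible x → w · x ℚ.≤ v)

  IsMin : Vector ℚ n → ℚ → Set
  IsMin w v = (∃ λ y → DualFeasible w y × b · y ≡ v)
            × (∀ y → DualFeasible w y → v ℚ.≤ b · y)

  -- The data being rational, a finite optimum is attained at rational
  -- points, so working over ℚ instead of ℝ changes nothing.
  TDI : Set
  TDI = ∀ (w : Vector ℤ n) (v : ℚ) →
    IsMax (fromℤ ∘ w) v → IsMin (fromℤ ∘ w) v →
    ∃ λ (y : Vector ℤ rows) →
      DualFeasible (fromℤ ∘ w) (fromℤ ∘ y) × b · (fromℤ ∘ y) ≡ v

open LinearSystem public using (TDI)

identity : ∀ n → Vector (Vector ℚ n) n
identity n i j = if does (i ≟ j) then 1ℚ else 0ℚ

-identity : ∀ n → Vector (Vector ℚ n) n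
-identity n i j = ℚ.- identity n i j

-- A x ≤ b, x ≤ u, - x ≤ - ℓ.
box : LinearSystem n → (ℓ u : Vector ℚ n) → LinearSystem n
box {n} L ℓ u = record
  { A = A VF.++ identity n VF.++ -identity n
  ; b = b VF.++ u VF.++ λ i → ℚ.- ℓ i
  }
  where open LinearSystem L

BoxTDI : LinearSystem n → Set
BoxTDI {n} L = ∀ (ℓ u : Vector ℚ n) → TDI (box L ℓ u)

cliques : Graph n → List (Subset n)
cliques {n} G = filter (isClique? G) (subsets n)

incidence : Subset n → Vector ℚ n
incidence S i = if lookup S i then 1ℚ else 0ℚ

-- x(C) ≤ 1 for all cliques C, and - x ≤ 0.
cliqueSystem : Graph n → LinearSystem n
cliqueSystem {n} G = record
  { A = VF.map incidence (VF.fromList (cliques G)) VF.++ -identity n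
  ; b = VF.replicate (length (cliques G)) 1ℚ VF.++ VF.replicate n 0ℚ
  }

BoxPerfect : Graph n → Set
BoxPerfect G = BoxTDI (cliqueSystem G)

------------------------------------------------------------------------
-- Total unimodularity

Matrix : ℕ → ℕ → Set
Matrix k l = Fin k → Fin l → ℤ

-- Laplace expansion along the first row.
det : Matrix n n → ℤ
det {zero}  M = 1ℤ
det {suc n} M = ∑ℤ λ j →
  (-1ℤ ℤ.^ toℕ j) ℤ.* M zero j ℤ.* det (λ i k → M (suc i) (punchIn j k))

submatrix : Matrix k l → (R : Subset k) (C : Subset l) → Matrix ∣ R ∣ ∣ C ∣
submatrix M R C i j = M (elements R i) (elements C j)

TotallyUnimodular : Matrix k l → Set
TotallyUnimodular {k} {l} M =
  ∀ (R : Subset k) (C : Subset l) (square : ∣ R ∣ ≡ ∣ C ∣) →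
  let d = det (λ i j → submatrix M R C i (cast square j))
  in d ≡ -1ℤ ⊎ d ≡ 0ℤ ⊎ d ≡ 1ℤ

MinimallyNonTU : Matrix k l → Set
MinimallyNonTU {k} {l} M =
  ¬ TotallyUnimodular M ×
  (∀ (R : Subset k) (C : Subset l) → ¬ (R ≡ ⊤ × C ≡ ⊤) →
    TotallyUnimodular (submatrix M R C))

------------------------------------------------------------------------
-- The class ℛ

-- A bipartite graph with colour classes U = Fin p and V = Fin q is given
-- by its edge relation E.
biadjacency : ∀ {p q} → (Fin p → Fin q → Bool) → Matrix p q
biadjacency E u v = if E u v then 1ℤ else 0ℤ

-- K′ = (U ∪ V , E ∪ F): the vertices u ↑ˡ q form U, the p ↑ʳ v form V, and
-- F is the set of added edges, viewed as a graph on V.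
augment : ∀ {p q} → (Fin p → Fin q → Bool) → Graph q → Graph (p + q)
augment {p} {q} E F = record
  { adj    = λ i j → adj′ (splitAt p i) (splitAt p j)
  ; sym    = λ i j → sym′ (splitAt p i) (splitAt p j)
  ; irrefl = λ i → irrefl′ (splitAt p i)
  }
  where
  adj′ : Fin p ⊎ Fin q → Fin p ⊎ Fin q → Bool
  adj′ (inj₁ u) (inj₁ u′) = false
  adj′ (inj₁ u) (inj₂ v)  = E u v
  adj′ (inj₂ v) (inj₁ u)  = E u v
  adj′ (inj₂ v) (inj₂ v′) = adj F v v′

  sym′ : ∀ i j → adj′ i j ≡ adj′ j i
  sym′ (inj₁ u) (inj₁ u′) = refl
  sym′ (inj₁ u) (inj₂ v)  = refl
  sym′ (inj₂ v) (inj₁ u)  = refl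
  sym′ (inj₂ v) (inj₂ v′) = sym F v v′

  irrefl′ : ∀ i → adj′ i i ≡ false
  irrefl′ (inj₁ u) = refl
  irrefl′ (inj₂ v) = irrefl F v

module _ {p q : ℕ} (E : Fin p → Fin q → Bool) (F : Graph q) where

  private
    K′ = augment E F

  Admissible : Set
  Admissible = MinimallyNonTU (biadjacency E)
             × (∀ (u : Fin p) → IsClique K′ (neighbourhood K′ (u ↑ˡ q)))

  -- N_{K′}(u) = V
  Dominates : Fin p → Set
  Dominates u = neighbourhood K′ (u ↑ˡ q) ≡ ⊥ {p} ++ⱽ ⊤ {q}

data ℛ (H : Graph n) : Set where
  deleted : ∀ {p q} (E : Fin p → Fin q → Bool) (F : Graph q) →
            Admissible E F →
            (u : Fin p) → Dominates E F u →
            H ≅ augment E F [ ∁ ⁅ u ↑ˡ q ⁆ ] → ℛ H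
  kept    : ∀ {p q} (E : Fin p → Fin q → Bool) (F : Graph q) →
            Admissible E F →
            ¬ ∃ (Dominates E F) →
            H ≅ augment E F → ℛ H

------------------------------------------------------------------------
-- The graph Gᵛ

module _ where
  private
    a b c d e x y z : Fin 8
    a = # 0
    b = # 1
    c = # 2
    d = # 3
    e = # 4
    x = # 5
    y = # 6
    z = # 7

    open ListMembership (≡-dec (_≟_ {8}) (_≟_ {8})) using () renaming (_∈?_ to _∈ᴱ?_)

    edges : List (Fin 8 × Fin 8)
    edges = (a , b) ∷ (a , c) ∷ (b , c) ∷ (b , d) ∷ (b , x) ∷ (b , y)
          ∷ (c , e) ∷ (c , x) ∷ (c , y) ∷ (d , y) ∷ (e , x) ∷ (x , z)
          ∷ (y , z) ∷ []

    edge : Fin 8 → Fin 8 → Bool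
    edge i j = does ((i , j) ∈ᴱ? edges)

    adjᵛ : Fin 8 → Fin 8 → Bool
    adjᵛ i j = edge i j ∨ edge j i

  Gᵛ : Graph 8
  Gᵛ = record
    { adj    = adjᵛ
    ; sym    = λ i j → ∨-comm (edge i j) (edge j i)
    ; irrefl = from-yes (all? λ i → adjᵛ i i ≟ᵇ false)
    }

{-# OPTIONS --safe #-}
module Submission where

-- Perfection: every vertex set S contains a clique with as many vertices as some proper colouring
-- of Gᵛ [ S ] has colours.
--
-- Box-perfection fails for the box x_a, x_d, x_e ≥ 1/2 and the objective x_b + x_c + x_x + x_y + x_z:
-- the cliques abc, bdy, cex, xz, yz meet the odd cycle b c x z y in its five edges, so the
-- optimum 7/4 has a half-integral dual solution, while an integral one would make an odd number even.
--
-- ℛ: a minimally non-totally-unimodular matrix is square with determinant outside {-1, 0, 1}.  If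
-- some N(u) = V, then |V| ≥ 4, as smaller matrices with a full row have determinant in {-1, 0, 1},
-- so the clique V contains a K₄, and Gᵛ has none.  Otherwise |U| = |V| ≤ 4 because Gᵛ has eight
-- vertices, and each N(u) has at most two elements because {u} ∪ N(u) is a clique.  Such a matrix
-- contains the incidence matrix of a triangle, so the graph contains a 3-sun, and Gᵛ has none.

open import Defs
open import Algebra.Bundles using (CommutativeRing)
open import Data.Bool using (Bool; false; T; _∨_; if_then_else_)
import Data.Bool.Properties as Boolₚ
open import Data.Fin using (Fin; zero; suc; toℕ; fromℕ<; cast; punchIn; inject≤; splitAt; _↑ˡ_; _↑ʳ_; #_)
open import Data.Fin.Permutation using (↔⇒≡)
open import Data.Fin.Properties as Finₚ using (_≟_; all?; any?; injective⇒≤; cast-is-id; splitAt-↑ˡ; splitAt-↑ʳ)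
open import Data.Fin.Subset using (Subset; inside; outside; _∈_; _⊆_; ∣_∣; ⊥; ⊤; ∁; ⁅_⁆)
open import Data.Fin.Subset.Properties
  using (_∈?_; _⊆?_; anySubset?; drop-∷-⊆; ∣⊤∣≡n; ∣p∣≤n; x≢y⇒x∉⁅y⁆; x∉p⇒x∈∁p)
open import Data.Integer as ℤ using (ℤ; 0ℤ; 1ℤ; -1ℤ)
import Data.Integer.Properties as ℤₚ
open import Data.List using (List; []; _∷_; length)
import Data.List.Membership.DecPropositional as ListMembership
open import Data.List.Membership.Propositional using (find)
open import Data.List.Relation.Unary.All as All using (All)
open import Data.List.Relation.Unary.All.Properties using (all-filter)
open import Data.List.Relation.Unary.Any as Any using (Any)
open import Data.Nat as ℕ using (ℕ; zero; suc; _+_; _≤_; _<_)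
import Data.Nat.Properties as ℕₚ
open import Data.Product using (_×_; _,_; ∃; proj₁; proj₂)
open import Data.Rational as ℚ using (ℚ; 0ℚ; 1ℚ; ½)
open import Data.Rational.Literals using (fromℤ)
import Data.Rational.Properties as ℚₚ
import Data.Rational.Unnormalised as ℚᵘ
import Data.Rational.Unnormalised.Properties as ℚᵘₚ
open import Data.Sum using (_⊎_; inj₁; inj₂)
open import Data.Unit using (tt) renaming (⊤ to Unit)
open import Data.Vec using (Vec; []; _∷_; lookup; tabulate; here; there)
open import Data.Vec.Functional as VF using (Vector)
import Data.Vec.Properties as Vecₚ
open import Data.Vec.Relation.Unary.All as AllV using ([]; _∷_)
import Data.Vec.Relation.Unary.All.Properties as AllVₚ
open import Function using (_∘_; case_of_; Inverse; Injection; Equivalence)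
open import Function.Properties.Inverse using (↔⇒↣; ↔-sym)
open import Relation.Nullary using (¬_; Dec; yes; no; does; contradiction)
open import Relation.Nullary.Decidable
  using (_→-dec_; _×-dec_; _⊎-dec_; ¬?; T?; from-yes; from-no; dec-false; map′; decidable-stable)
open import Relation.Binary.PropositionalEquality as ≡
  using (_≡_; _≢_; refl; trans; cong; cong₂; subst)
import Algebra.Properties.CommutativeMonoid.Sum ℤₚ.+-0-commutativeMonoid as ℤSum
import Algebra.Properties.Semiring.Sum (CommutativeRing.semiring ℚₚ.+-*-commutativeRing) as ℚSum
open ListMembership (Vecₚ.≡-dec {n = 8} Boolₚ._≟_) using () renaming (_∈?_ to _∈ᴸ?_)

private
  variable
    m n k p q : ℕ

-- Perfection

allSubsets? : {P : Subset n → Set} → (∀ S → Dec (P S)) → Dec (∀ S → P S)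
allSubsets? P? = map′ (λ ∄ S → decidable-stable (P? S) λ ¬PS → ∄ (S , ¬PS))
                      (λ ∀P (S , ¬PS) → ¬PS (∀P S))
                      (¬? (anySubset? (¬? ∘ P?)))

elements-∈ : (S : Subset n) (i : Fin ∣ S ∣) → elements S i ∈ S
elements-∈ (inside  ∷ S) zero    = here
elements-∈ (inside  ∷ S) (suc i) = there (elements-∈ S i)
elements-∈ (outside ∷ S) i       = there (elements-∈ S i)

elements-injective : (S : Subset n) {i j : Fin ∣ S ∣} → elements S i ≡ elements S j → i ≡ j
elements-injective (inside  ∷ S) {zero}  {zero}  eq = refl
elements-injective (inside  ∷ S) {suc i} {suc j} eq =
  cong suc (elements-injective S (Finₚ.suc-injective eq))
elements-injective (outside ∷ S) eq = elements-injective S (Finₚ.suc-injective eq)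

elements-surjective : {S : Subset n} {i : Fin n} → i ∈ S → ∃ λ j → elements S j ≡ i
elements-surjective {S = inside ∷ S}  here      = zero , refl
elements-surjective {S = inside ∷ S}  (there p) with elements-surjective p
... | j , eq = suc j , cong suc eq
elements-surjective {S = outside ∷ S} (there p) with elements-surjective p
... | j , eq = j , cong suc eq

-- C ∩ S as a set of vertices of G [ S ].
restrict : (S C : Subset n) → Subset ∣ S ∣
restrict []            []      = []
restrict (inside  ∷ S) (s ∷ C) = s ∷ restrict S C
restrict (outside ∷ S) (s ∷ C) = restrict S C

∈-restrict⁻ : (S C : Subset n) {i : Fin ∣ S ∣} → i ∈ restrict S C → elements S i ∈ C
∈-restrict⁻ (inside  ∷ S) (s ∷ C) here      = here
∈-restrict⁻ (inside  ∷ S) (s ∷ C) (there p) = there (∈-restrict⁻ S C p)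
∈-restrict⁻ (outside ∷ S) (s ∷ C) p         = there (∈-restrict⁻ S C p)

∣restrict∣ : (S C : Subset n) → C ⊆ S → ∣ restrict S C ∣ ≡ ∣ C ∣
∣restrict∣ []            []            C⊆S = refl
∣restrict∣ (inside  ∷ S) (inside  ∷ C) C⊆S = cong suc (∣restrict∣ S C (drop-∷-⊆ C⊆S))
∣restrict∣ (inside  ∷ S) (outside ∷ C) C⊆S = ∣restrict∣ S C (drop-∷-⊆ C⊆S)
∣restrict∣ (outside ∷ S) (inside  ∷ C) C⊆S with () ← C⊆S here
∣restrict∣ (outside ∷ S) (outside ∷ C) C⊆S = ∣restrict∣ S C (drop-∷-⊆ C⊆S)

restrict-isClique : (G : Graph n) (S : Subset n) {C : Subset n} →
                    IsClique G C → IsClique (G [ S ]) (restrict S C)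
restrict-isClique G S {C} clique i j i∈ j∈ i≢j =
  clique _ _ (∈-restrict⁻ S C i∈) (∈-restrict⁻ S C j∈) (i≢j ∘ elements-injective S)

clique≤colours : (G : Graph n) {C : Subset n} → IsClique G C → Colourable G k → ∣ C ∣ ≤ k
clique≤colours G {C} clique (c , proper) = injective⇒≤ {f = c ∘ elements C} inj
  where
  inj : ∀ {i j} → c (elements C i) ≡ c (elements C j) → i ≡ j
  inj {i} {j} eq = decidable-stable (i ≟ j) λ i≢j →
    proper _ _ (clique _ _ (elements-∈ C i) (elements-∈ C j) (i≢j ∘ elements-injective C)) eq

-- The colours ≥ k mark the vertices left uncoloured.
ProperPartial : Graph n → ℕ → (Fin n → ℕ) → Set
ProperPartial G k c = ∀ i j → Adj G i j → c i < k → c i ≢ c j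

properPartial? : (G : Graph n) → ∀ k c → Dec (ProperPartial G k c)
properPartial? G k c = all? λ i → all? λ j →
  T? (adj G i j) →-dec ((c i ℕ.<? k) →-dec ¬? (c i ℕ.≟ c j))

Colours : ℕ → (Fin n → ℕ) → Subset n → Set
Colours k c S = ∀ i → i ∈ S → c i < k

properPartial⇒colourable : (G : Graph n) (S : Subset n) {c : Fin n → ℕ} →
                           ProperPartial G k c → Colours k c S → Colourable (G [ S ]) k
properPartial⇒colourable G S {c} proper colours =
  (λ i → fromℕ< (colours _ (elements-∈ S i))) ,
  λ i j i~j → proper _ _ i~j (colours _ (elements-∈ S i)) ∘ Finₚ.fromℕ<-injective _ _ _ _

-- The colouring bounds every clique from above and the clique bounds every colouring from below, so
-- both numbers are `∣ C ∣`.
clique+colouring⇒perfect : (G : Graph n) (S : Subset n) {C : Subset n} →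
  IsClique G C → C ⊆ S → Colourable (G [ S ]) ∣ C ∣ →
  ∃ λ k → IsChromaticNumber (G [ S ]) k × IsCliqueNumber (G [ S ]) k
clique+colouring⇒perfect G S {C} clique C⊆S colourable = ∣ C ∣ ,
  (colourable , λ j col → subst (_≤ j) ∣C∣≡ (clique≤colours (G [ S ]) clique′ col)) ,
  (restrict S C , clique′ , ∣C∣≡) ,
  λ D D-clique → clique≤colours (G [ S ]) D-clique colourable
  where
  clique′ = restrict-isClique G S clique
  ∣C∣≡    = ∣restrict∣ S C C⊆S

-- Vertices in the order a b c d e x y z.
pattern I = inside
pattern O = outside

-- Listed in the order of enumeration of `subsets 8`, so that `cliques-Gᵛ` holds by `refl`.
cliqueList : List (Subset 8)
cliqueList =
  (O ∷ O ∷ O ∷ O ∷ O ∷ O ∷ O ∷ O ∷ []) ∷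
  (O ∷ O ∷ O ∷ O ∷ O ∷ O ∷ O ∷ I ∷ []) ∷
  (O ∷ O ∷ O ∷ O ∷ O ∷ O ∷ I ∷ O ∷ []) ∷
  (O ∷ O ∷ O ∷ O ∷ O ∷ O ∷ I ∷ I ∷ []) ∷
  (O ∷ O ∷ O ∷ O ∷ O ∷ I ∷ O ∷ O ∷ []) ∷
  (O ∷ O ∷ O ∷ O ∷ O ∷ I ∷ O ∷ I ∷ []) ∷
  (O ∷ O ∷ O ∷ O ∷ I ∷ O ∷ O ∷ O ∷ []) ∷
  (O ∷ O ∷ O ∷ O ∷ I ∷ I ∷ O ∷ O ∷ []) ∷
  (O ∷ O ∷ O ∷ I ∷ O ∷ O ∷ O ∷ O ∷ []) ∷
  (O ∷ O ∷ O ∷ I ∷ O ∷ O ∷ I ∷ O ∷ []) ∷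
  (O ∷ O ∷ I ∷ O ∷ O ∷ O ∷ O ∷ O ∷ []) ∷
  (O ∷ O ∷ I ∷ O ∷ O ∷ O ∷ I ∷ O ∷ []) ∷
  (O ∷ O ∷ I ∷ O ∷ O ∷ I ∷ O ∷ O ∷ []) ∷
  (O ∷ O ∷ I ∷ O ∷ I ∷ O ∷ O ∷ O ∷ []) ∷
  (O ∷ O ∷ I ∷ O ∷ I ∷ I ∷ O ∷ O ∷ []) ∷
  (O ∷ I ∷ O ∷ O ∷ O ∷ O ∷ O ∷ O ∷ []) ∷
  (O ∷ I ∷ O ∷ O ∷ O ∷ O ∷ I ∷ O ∷ []) ∷
  (O ∷ I ∷ O ∷ O ∷ O ∷ I ∷ O ∷ O ∷ []) ∷
  (O ∷ I ∷ O ∷ I ∷ O ∷ O ∷ O ∷ O ∷ []) ∷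
  (O ∷ I ∷ O ∷ I ∷ O ∷ O ∷ I ∷ O ∷ []) ∷
  (O ∷ I ∷ I ∷ O ∷ O ∷ O ∷ O ∷ O ∷ []) ∷
  (O ∷ I ∷ I ∷ O ∷ O ∷ O ∷ I ∷ O ∷ []) ∷
  (O ∷ I ∷ I ∷ O ∷ O ∷ I ∷ O ∷ O ∷ []) ∷
  (I ∷ O ∷ O ∷ O ∷ O ∷ O ∷ O ∷ O ∷ []) ∷
  (I ∷ O ∷ I ∷ O ∷ O ∷ O ∷ O ∷ O ∷ []) ∷
  (I ∷ I ∷ O ∷ O ∷ O ∷ O ∷ O ∷ O ∷ []) ∷
  (I ∷ I ∷ I ∷ O ∷ O ∷ O ∷ O ∷ O ∷ []) ∷
  []

abstract
  cliques-Gᵛ : cliques Gᵛ ≡ cliqueList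
  cliques-Gᵛ = refl

-- Chosen so that every vertex set with clique number k lies in the coloured part of an entry for k.
-- The entries for 1 are the six maximal stable sets; the entry for 0 serves the empty set.
partialColourings : List (ℕ × Vec ℕ 8)
partialColourings
  = (3 , 0 ∷ 1 ∷ 2 ∷ 2 ∷ 1 ∷ 0 ∷ 0 ∷ 1 ∷ [])
  ∷ (2 , 2 ∷ 0 ∷ 1 ∷ 1 ∷ 0 ∷ 2 ∷ 2 ∷ 0 ∷ [])
  ∷ (2 , 0 ∷ 1 ∷ 2 ∷ 0 ∷ 1 ∷ 0 ∷ 2 ∷ 1 ∷ [])
  ∷ (2 , 0 ∷ 1 ∷ 2 ∷ 2 ∷ 1 ∷ 0 ∷ 0 ∷ 1 ∷ [])
  ∷ (2 , 0 ∷ 2 ∷ 1 ∷ 1 ∷ 0 ∷ 2 ∷ 0 ∷ 1 ∷ [])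
  ∷ (2 , 0 ∷ 2 ∷ 1 ∷ 1 ∷ 2 ∷ 0 ∷ 0 ∷ 1 ∷ [])
  ∷ (2 , 0 ∷ 2 ∷ 2 ∷ 0 ∷ 0 ∷ 1 ∷ 1 ∷ 0 ∷ [])
  ∷ (1 , 0 ∷ 1 ∷ 1 ∷ 0 ∷ 1 ∷ 0 ∷ 1 ∷ 1 ∷ [])
  ∷ (1 , 0 ∷ 1 ∷ 1 ∷ 1 ∷ 0 ∷ 1 ∷ 0 ∷ 1 ∷ [])
  ∷ (1 , 0 ∷ 1 ∷ 1 ∷ 1 ∷ 1 ∷ 0 ∷ 0 ∷ 1 ∷ [])
  ∷ (1 , 1 ∷ 0 ∷ 1 ∷ 1 ∷ 0 ∷ 1 ∷ 1 ∷ 0 ∷ [])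
  ∷ (1 , 1 ∷ 1 ∷ 0 ∷ 0 ∷ 1 ∷ 1 ∷ 1 ∷ 0 ∷ [])
  ∷ (1 , 0 ∷ 1 ∷ 1 ∷ 0 ∷ 0 ∷ 1 ∷ 1 ∷ 0 ∷ [])
  ∷ (0 , 0 ∷ 0 ∷ 0 ∷ 0 ∷ 0 ∷ 0 ∷ 0 ∷ 0 ∷ [])
  ∷ []

cliqueList-cliques : All (IsClique Gᵛ) cliqueList
cliqueList-cliques = subst (All (IsClique Gᵛ)) cliques-Gᵛ (all-filter (isClique? Gᵛ) (subsets 8))

partialColourings-proper : All (λ (k , c) → ProperPartial Gᵛ k (lookup c)) partialColourings
partialColourings-proper = from-yes (All.all? (λ (k , c) → properPartial? Gᵛ k (lookup c)) partialColourings)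

OptimallyColoured : Subset 8 → Set
OptimallyColoured S = Any (λ C → C ⊆ S × Any (λ (k , c) → k ≡ ∣ C ∣ × Colours k (lookup c) S) partialColourings)
                          cliqueList

optimallyColoured? : ∀ S → Dec (OptimallyColoured S)
optimallyColoured? S = Any.any? (λ C → (C ⊆? S) ×-dec Any.any? (λ (k , c) →
  (k ℕ.≟ ∣ C ∣) ×-dec all? λ i → (i ∈? S) →-dec (lookup c i ℕ.<? k)) partialColourings) cliqueList

abstract
  optimallyColoured : ∀ S → OptimallyColoured S
  optimallyColoured = from-yes (allSubsets? optimallyColoured?)

perfect-Gᵛ : Perfect Gᵛ
perfect-Gᵛ S with find (optimallyColoured S)
... | C , C∈ , C⊆S , coloured with find coloured
... | (_ , c) , c∈ , refl , colours =
  clique+colouring⇒perfect Gᵛ S (All.lookup cliqueList-cliques C∈) C⊆S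
    (properPartial⇒colourable Gᵛ S (All.lookup partialColourings-proper c∈) colours)

-- Minimally non-totally-unimodular matrices

UnitOrZero : ℤ → Set
UnitOrZero d = d ≡ -1ℤ ⊎ d ≡ 0ℤ ⊎ d ≡ 1ℤ

unitOrZero? : ∀ d → Dec (UnitOrZero d)
unitOrZero? d = (d ℤ.≟ -1ℤ) ⊎-dec ((d ℤ.≟ 0ℤ) ⊎-dec (d ℤ.≟ 1ℤ))

det-cong : {M N : Matrix n n} → (∀ i j → M i j ≡ N i j) → det M ≡ det N
det-cong {zero}  M≗N = refl
det-cong {suc n} M≗N = ℤSum.sum-cong-≗ λ j →
  cong₂ ℤ._*_ (cong ((-1ℤ ℤ.^ toℕ j) ℤ.*_) (M≗N zero j))
              (det-cong λ i k → M≗N (suc i) (punchIn j k))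

det-cast : (eq : m ≡ n) (N : Matrix n n) → det (λ i j → N (cast eq i) (cast eq j)) ≡ det N
det-cast refl N = det-cong λ i j → cong₂ N (cast-is-id refl i) (cast-is-id refl j)

elements-⊤ : ∀ n i → elements (⊤ {n}) i ≡ cast (∣⊤∣≡n n) i
elements-⊤ (suc n) zero    = refl
elements-⊤ (suc n) (suc i) = cong suc (elements-⊤ n i)

-- The full submatrix is indexed by `Fin ∣ ⊤ ∣`, which equals `Fin n` only propositionally; hence
-- the casts.
det-⊤ : (M : Matrix n n) (square : ∣ ⊤ {n} ∣ ≡ ∣ ⊤ {n} ∣) →
        det (λ i j → submatrix M ⊤ ⊤ i (cast square j)) ≡ det M
det-⊤ {n} M square = trans
  (det-cong λ i j → cong₂ M (elements-⊤ n i)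
    (trans (elements-⊤ n _) (cong (cast (∣⊤∣≡n n)) (cast-is-id square j))))
  (det-cast (∣⊤∣≡n n) M)

totallyUnimodular⇒det : (M : Matrix m n) → TotallyUnimodular M → (eq : m ≡ n) →
                        UnitOrZero (det λ i j → M i (cast eq j))
totallyUnimodular⇒det M tu refl = subst UnitOrZero
  (trans (det-⊤ M refl) (det-cong λ i j → cong (M i) (≡.sym (cast-is-id refl j))))
  (tu ⊤ ⊤ refl)

-- If `m ≢ n`, every square submatrix is proper, so minimality would make `M` totally unimodular.
minimallyNonTU⇒square : (M : Matrix m n) → MinimallyNonTU M → m ≡ n
minimallyNonTU⇒square {m} {n} M (¬tu , proper) = decidable-stable (m ℕ.≟ n) λ m≢n →
  ¬tu λ R C square → totallyUnimodular⇒det (submatrix M R C)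
    (proper R C λ { (refl , refl) → m≢n (trans (≡.sym (∣⊤∣≡n m)) (trans square (∣⊤∣≡n n))) })
    square

-- The only square submatrix that minimality leaves open is `M` itself.
minimallyNonTU⇒det : (M : Matrix n n) → MinimallyNonTU M → ¬ UnitOrZero (det M)
minimallyNonTU⇒det {n} M (¬tu , proper) ok = ¬tu tu
  where
  tu : TotallyUnimodular M
  tu R C square with Vecₚ.≡-dec Boolₚ._≟_ R ⊤ ×-dec Vecₚ.≡-dec Boolₚ._≟_ C ⊤
  ... | yes (refl , refl) = subst UnitOrZero (≡.sym (det-⊤ M square)) ok
  ... | no  notFull       = totallyUnimodular⇒det (submatrix M R C) (proper R C notFull) square

-- Suns and determinants of small 0/1 matrices, by enumeration

biadjacency-det : (E E′ : Fin n → Fin n → Bool) → (∀ u v → E u v ≡ E′ u v) →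
                  det (biadjacency E) ≡ det (biadjacency E′)
biadjacency-det E E′ E≗E′ = det-cong λ u v → cong (λ e → if e then 1ℤ else 0ℤ) (E≗E′ u v)

Separates : {A B : Set} → (A → B → Bool) → B → B → B → Set
Separates E v₁ v₂ v₃ = ∃ λ u → E u v₁ ≡ false × T (E u v₂) × T (E u v₃)

-- A 3 × 3 submatrix J - I: the incidence matrix of a triangle, with determinant 2.
Sun : {A B : Set} → (A → B → Bool) → B → B → B → Set
Sun E v₁ v₂ v₃ = Separates E v₁ v₂ v₃ × Separates E v₂ v₁ v₃ × Separates E v₃ v₁ v₂

HasSun : {A B : Set} → (A → B → Bool) → Set
HasSun E = ∃ λ v₁ → ∃ λ v₂ → ∃ (Sun E v₁ v₂)

sun? : (E : Fin m → Fin n → Bool) → ∀ v₁ v₂ v₃ → Dec (Sun E v₁ v₂ v₃)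
sun? E v₁ v₂ v₃ = separates? v₁ v₂ v₃ ×-dec (separates? v₂ v₁ v₃ ×-dec separates? v₃ v₁ v₂)
  where
  separates? : ∀ v₁ v₂ v₃ → Dec (Separates E v₁ v₂ v₃)
  separates? v₁ v₂ v₃ = any? λ u → (E u v₁ Boolₚ.≟ false) ×-dec (T? (E u v₂) ×-dec T? (E u v₃))

hasSun? : (E : Fin m → Fin n → Bool) → Dec (HasSun E)
hasSun? E = any? λ v₁ → any? λ v₂ → any? λ v₃ → sun? E v₁ v₂ v₃

-- Testing `Q` on each row before the later rows are chosen prunes the search: for `sparseSun?` at
-- order 4 it leaves 11⁴ of the 16⁴ tables.
allTables? : {Q : Subset n → Set} → (∀ r → Dec (Q r)) →
             {P : Vec (Subset n) m → Set} → (∀ rs → Dec (P rs)) → Dec (∀ rs → AllV.All Q rs → P rs)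
allTables? {m = zero}  Q? P? = map′ (λ { P[] [] [] → P[] }) (λ ∀P → ∀P [] []) (P? [])
allTables? {m = suc m} Q? P? = map′
  (λ { ∀P (r ∷ rs) (q ∷ qs) → ∀P r q rs qs })
  (λ ∀P r q rs qs → ∀P (r ∷ rs) (q ∷ qs))
  (allSubsets? λ r → Q? r →-dec allTables? Q? λ rs → P? (r ∷ rs))

relation : Vec (Subset n) m → Fin m → Fin n → Bool
relation rs u = lookup (lookup rs u)

rowSets : (Fin m → Fin n → Bool) → Vec (Subset n) m
rowSets E = tabulate (tabulate ∘ E)

relation-rowSets : (E : Fin m → Fin n → Bool) → ∀ u v → relation (rowSets E) u v ≡ E u v
relation-rowSets E u v = trans (cong (λ r → lookup r v) (Vecₚ.lookup∘tabulate (tabulate ∘ E) u))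
                            (Vecₚ.lookup∘tabulate (E u) v)

-- Rows with two ones are edges of a graph on the columns; rows with one expand away. Incidence
-- matrices of bipartite graphs are totally unimodular, so a bad determinant needs an odd cycle, and
-- on at most four vertices this is a triangle.
SparseSun : ∀ n → Set
SparseSun n = (rs : Vec (Subset n) n) → AllV.All (λ r → ∣ r ∣ ≤ 2) rs →
              UnitOrZero (det (biadjacency (relation rs))) ⊎ HasSun (relation rs)

sparseSun? : ∀ n → Dec (SparseSun n)
sparseSun? n = allTables? (λ r → ∣ r ∣ ℕ.≤? 2) λ rs →
  unitOrZero? (det (biadjacency (relation rs))) ⊎-dec hasSun? (relation rs)

-- True for n ≤ 3: subtracting one column from the others makes the full row a unit vector and
-- leaves, up to row signs, a 0/1 matrix of order at most 2. The trivial row condition fits the form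
-- of `allTables?`.
FullRow : ∀ n → Set
FullRow n = (rs : Vec (Subset n) n) → AllV.All (λ _ → Unit) rs → ∀ u → (∀ v → T (relation rs u v)) →
            UnitOrZero (det (biadjacency (relation rs)))

fullRow? : ∀ n → Dec (FullRow n)
fullRow? n = allTables? (λ _ → yes tt) λ rs → all? λ u →
  all? (λ v → T? (relation rs u v)) →-dec unitOrZero? (det (biadjacency (relation rs)))

-- Each adjacency follows the vertices it restricts, so that the decision procedure abandons a
-- branch early.
K₄-Free : Graph n → Set
K₄-Free G = ∀ i j → Adj G i j → ∀ k → Adj G i k → Adj G j k →
            ∀ l → Adj G i l → Adj G j l → ¬ Adj G k l

k₄-free? : (G : Graph n) → Dec (K₄-Free G)
k₄-free? G = all? λ i → all? λ j → T? (adj G i j) →-dec all? λ k →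
  T? (adj G i k) →-dec (T? (adj G j k) →-dec all? λ l →
  T? (adj G i l) →-dec (T? (adj G j l) →-dec ¬? (T? (adj G k l))))

-- With plain adjacency v₁ would count as a vertex not adjacent to v₁ in a sun of G.
closedAdj : Graph n → Fin n → Fin n → Bool
closedAdj G i j = does (i ≟ j) ∨ adj G i j

-- Separating vertices lie outside the triangle, whose vertices are closed-adjacent to all of it.
-- Edges among them are left open, so more than induced 3-suns is excluded.
SunFree : Graph n → Set
SunFree G = ∀ i j → Adj G i j → ∀ k → Adj G i k → Adj G j k → ¬ Sun (closedAdj G) i j k

sunFree? : (G : Graph n) → Dec (SunFree G)
sunFree? G = all? λ i → all? λ j → T? (adj G i j) →-dec all? λ k →
  T? (adj G i k) →-dec (T? (adj G j k) →-dec ¬? (sun? (closedAdj G) i j k))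

abstract
  k₄-free : K₄-Free Gᵛ
  k₄-free = from-yes (k₄-free? Gᵛ)

  sunFree : SunFree Gᵛ
  sunFree = from-yes (sunFree? Gᵛ)

  fullRow : ∀ (n : Fin 4) → FullRow (toℕ n)
  fullRow = from-yes (all? λ (n : Fin 4) → fullRow? (toℕ n))

  sparseSun : ∀ (n : Fin 5) → SparseSun (toℕ n)
  sparseSun = from-yes (all? λ (n : Fin 5) → sparseSun? (toℕ n))

fullRow⇒unitOrZero : n < 4 → (E : Fin n → Fin n → Bool) → ∀ u → (∀ v → T (E u v)) →
                     UnitOrZero (det (biadjacency E))
fullRow⇒unitOrZero n<4 E u full = subst UnitOrZero
  (biadjacency-det (relation (rowSets E)) E (relation-rowSets E))
  (subst FullRow (Finₚ.toℕ-fromℕ< n<4) (fullRow (fromℕ< n<4))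
    (rowSets E) (AllV.universal _ (rowSets E)) u λ v → subst T (≡.sym (relation-rowSets E u v)) (full v))

hasSun-cong : {A B : Set} {E E′ : A → B → Bool} → (∀ u v → E u v ≡ E′ u v) → HasSun E → HasSun E′
hasSun-cong {E = E} {E′} E≗E′ (v₁ , v₂ , v₃ , s₁ , s₂ , s₃) =
  v₁ , v₂ , v₃ , move {v₁} {v₂} {v₃} s₁ , move {v₂} {v₁} {v₃} s₂ , move {v₃} {v₁} {v₂} s₃
  where
  move : ∀ {v₁ v₂ v₃} → Separates E v₁ v₂ v₃ → Separates E′ v₁ v₂ v₃
  move (u , u≁v₁ , u~v₂ , u~v₃) =
    u , trans (≡.sym (E≗E′ u _)) u≁v₁ , subst T (E≗E′ u _) u~v₂ , subst T (E≗E′ u _) u~v₃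

sparse⇒hasSun : n < 5 → (E : Fin n → Fin n → Bool) → (∀ u → ∣ tabulate (E u) ∣ ≤ 2) →
                ¬ UnitOrZero (det (biadjacency E)) → HasSun E
sparse⇒hasSun n<5 E sparse bad
  with subst SparseSun (Finₚ.toℕ-fromℕ< n<5) (sparseSun (fromℕ< n<5))
             (rowSets E) (AllVₚ.tabulate⁺ sparse)
... | inj₁ ok  = contradiction
  (subst UnitOrZero (biadjacency-det (relation (rowSets E)) E (relation-rowSets E)) ok) bad
... | inj₂ sun = hasSun-cong (relation-rowSets E) sun

-- Embedding the augmented graph

↑ˡ≢↑ʳ : (i : Fin m) (j : Fin n) → i ↑ˡ n ≢ m ↑ʳ j
↑ˡ≢↑ʳ {m} {n} i j eq = case
  trans (≡.sym (splitAt-↑ˡ m i n)) (trans (cong (splitAt m) eq) (splitAt-↑ʳ m n j)) of λ ()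

module _ {p q : ℕ} (E : Fin p → Fin q → Bool) (F : Graph q) where

  private
    K′ = augment E F

  augment-UV : ∀ u v → adj K′ (u ↑ˡ q) (p ↑ʳ v) ≡ E u v
  augment-UV u v rewrite splitAt-↑ˡ p u q | splitAt-↑ʳ p q v = refl

  ∈-neighbourhood : (G : Graph n) {i j : Fin n} → Adj G i j → j ∈ neighbourhood G i
  ∈-neighbourhood G {i} {j} i~j = Vecₚ.lookup⇒[]= j _
    (trans (Vecₚ.lookup∘tabulate (adj G i) j) (Equivalence.to Boolₚ.T-≡ i~j))

  common-neighbours : (∀ u → IsClique K′ (neighbourhood K′ (u ↑ˡ q))) →
                      ∀ u {v v′} → T (E u v) → T (E u v′) →
                      v ≢ v′ → Adj K′ (p ↑ʳ v) (p ↑ʳ v′)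
  common-neighbours cliques u {v} {v′} u~v u~v′ v≢v′ =
    cliques u _ _ (member u~v) (member u~v′) (v≢v′ ∘ Finₚ.↑ʳ-injective p v v′)
    where
    member : ∀ {v} → T (E u v) → p ↑ʳ v ∈ neighbourhood K′ (u ↑ˡ q)
    member = ∈-neighbourhood K′ ∘ subst T (≡.sym (augment-UV u _))

  dominates⇒full : ∀ {u} → Dominates E F u → ∀ v → T (E u v)
  dominates⇒full {u} dom v = Equivalence.from Boolₚ.T-≡ (
    trans (≡.sym (augment-UV u v)) (
    trans (≡.sym (Vecₚ.lookup∘tabulate (adj K′ (u ↑ˡ q)) (p ↑ʳ v))) (
    trans (cong (λ N → lookup N (p ↑ʳ v)) dom) (
    trans (Vecₚ.lookup-++ʳ (⊥ {p}) (⊤ {q}) v) (Vecₚ.lookup-replicate v inside)))))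

-- The inverse isomorphism followed by `elements S` places `H` in `G` as an induced subgraph.
≅-induced : (G : Graph n) (S : Subset n) {H : Graph m} (iso : G [ S ] ≅ H) → ∀ i j →
            let φ = elements S ∘ Inverse.from (_≅_.bijection iso)
            in adj H i j ≡ adj G (φ i) (φ j)
≅-induced G S {H} iso i j = ≡.sym (trans (adj-preserve _ _)
  (cong₂ (adj H) (Inverse.strictlyInverseˡ bijection i) (Inverse.strictlyInverseˡ bijection j)))
  where open _≅_ iso

module Embedding {G : Graph n} {E : Fin p → Fin q → Bool} {F : Graph q}
  (cliques : ∀ u → IsClique (augment E F) (neighbourhood (augment E F) (u ↑ˡ q)))
  (φ : Fin (p + q) → Fin n) (φ-injective : ∀ {i j} → φ i ≡ φ j → i ≡ j)
  (φ-adj : ∀ i j → adj (augment E F) i j ≡ adj G (φ i) (φ j)) where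

  adj-UV : ∀ u v → adj G (φ (u ↑ˡ q)) (φ (p ↑ʳ v)) ≡ E u v
  adj-UV u v = trans (≡.sym (φ-adj (u ↑ˡ q) (p ↑ʳ v))) (augment-UV E F u v)

  adjacent-UV : ∀ {u v} → T (E u v) → Adj G (φ (u ↑ˡ q)) (φ (p ↑ʳ v))
  adjacent-UV = subst T (≡.sym (adj-UV _ _))

  adjacent-VV : ∀ u {v v′} → T (E u v) → T (E u v′) → v ≢ v′ → Adj G (φ (p ↑ʳ v)) (φ (p ↑ʳ v′))
  adjacent-VV u u~v u~v′ v≢v′ = subst T (φ-adj _ _) (common-neighbours E F cliques u u~v u~v′ v≢v′)

  k₄-free⇒sparse : K₄-Free G → ∀ u → ∣ tabulate (E u) ∣ ≤ 2
  k₄-free⇒sparse k₄-free u = ℕₚ.≮⇒≥ λ 2<∣N∣ →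
    let v : Fin 3 → Fin q
        v i = elements (tabulate (E u)) (inject≤ i 2<∣N∣)

        u~v : ∀ i → T (E u (v i))
        u~v i = Equivalence.from Boolₚ.T-≡ (trans (≡.sym (Vecₚ.lookup∘tabulate (E u) (v i)))
          (Vecₚ.[]=⇒lookup (elements-∈ (tabulate (E u)) (inject≤ i 2<∣N∣))))

        v~v : ∀ i j → i ≢ j → Adj G (φ (p ↑ʳ v i)) (φ (p ↑ʳ v j))
        v~v i j i≢j = adjacent-VV u (u~v i) (u~v j)
          (i≢j ∘ Finₚ.inject≤-injective 2<∣N∣ 2<∣N∣ i j ∘ elements-injective (tabulate (E u)))
    in k₄-free _ _ (adjacent-UV (u~v (# 0)))
         _ (adjacent-UV (u~v (# 1))) (v~v (# 0) (# 1) λ ())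
         _ (adjacent-UV (u~v (# 2))) (v~v (# 0) (# 2) λ ()) (v~v (# 1) (# 2) λ ())

  -- Any two of the `v` share a neighbour in `U`, whose neighbourhood is a clique, so the three form
  -- a triangle in `G`, and the images of the `u` separate it.
  sunFree⇒¬hasSun : SunFree G → ¬ HasSun E
  sunFree⇒¬hasSun sunFree (v₁ , v₂ , v₃ , s₁@(u₁ , u₁≁v₁ , u₁~v₂ , u₁~v₃) ,
                           s₂@(u₂ , u₂≁v₂ , u₂~v₁ , u₂~v₃) , s₃@(u₃ , u₃≁v₃ , u₃~v₁ , u₃~v₂)) =
    sunFree _ _ (adjacent-VV u₃ u₃~v₁ u₃~v₂ (distinct u₁ u₁≁v₁ u₁~v₂))
            _ (adjacent-VV u₂ u₂~v₁ u₂~v₃ (distinct u₁ u₁≁v₁ u₁~v₃))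
              (adjacent-VV u₁ u₁~v₂ u₁~v₃ (distinct u₂ u₂≁v₂ u₂~v₃))
              (separates {v₁} {v₂} {v₃} s₁ , separates {v₂} {v₁} {v₃} s₂ , separates {v₃} {v₁} {v₂} s₃)
    where
    distinct : ∀ u {v v′} → E u v ≡ false → T (E u v′) → v ≢ v′
    distinct u u≁v u~v′ refl = subst T u≁v u~v′

    closed : ∀ {i j} → Adj G i j → T (closedAdj G i j)
    closed = Equivalence.from Boolₚ.T-∨ ∘ inj₂

    separates : ∀ {v₁ v₂ v₃} → Separates E v₁ v₂ v₃ →
                Separates (closedAdj G) (φ (p ↑ʳ v₁)) (φ (p ↑ʳ v₂)) (φ (p ↑ʳ v₃))
    separates {v₁} (u , u≁v₁ , u~v₂ , u~v₃) = φ (u ↑ˡ q) ,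
      -- `U` and `V` stay disjoint under the injective `φ`, so the equality test in `closedAdj`
      -- fails.
      cong₂ _∨_ (dec-false (φ (u ↑ˡ q) ≟ φ (p ↑ʳ v₁)) (↑ˡ≢↑ʳ u v₁ ∘ φ-injective))
                (trans (adj-UV u v₁) u≁v₁) ,
      closed (adjacent-UV u~v₂) , closed (adjacent-UV u~v₃)

-- Exclusion of ℛ

module _ (G : Graph n) (k₄-free : K₄-Free G) (S : Subset n) where

  -- Only a vertex of `U` is deleted, so the whole clique `V` survives in `G [ S ]`. Order below 4
  -- is ruled out by the full row `u`.
  deleted-∉ : (E : Fin p → Fin q → Bool) (F : Graph q) → Admissible E F →
              (u : Fin p) → Dominates E F u → ¬ G [ S ] ≅ augment E F [ ∁ ⁅ u ↑ˡ q ⁆ ]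
  deleted-∉ {p} E F (nonTU , cliques) u dom iso with minimallyNonTU⇒square (biadjacency E) nonTU
  ... | refl with p ℕ.<? 4
  ... | yes p<4 = minimallyNonTU⇒det (biadjacency E) nonTU
    (fullRow⇒unitOrZero p<4 E u (dominates⇒full E F dom))
  ... | no  p≮4 = k₄-free _ _ (v~v (# 0) (# 1) λ ()) _ (v~v (# 0) (# 2) λ ())
    (v~v (# 1) (# 2) λ ()) _ (v~v (# 0) (# 3) λ ()) (v~v (# 1) (# 3) λ ()) (v~v (# 2) (# 3) λ ())
    where
    v : Fin 4 → Fin p
    v i = inject≤ i (ℕₚ.≮⇒≥ p≮4)

    survives : ∀ w → p ↑ʳ w ∈ ∁ ⁅ u ↑ˡ p ⁆
    survives w = x∉p⇒x∈∁p (x≢y⇒x∉⁅y⁆ (↑ˡ≢↑ʳ u w ∘ ≡.sym))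

    index : Fin p → Fin ∣ ∁ ⁅ u ↑ˡ p ⁆ ∣
    index w = proj₁ (elements-surjective (survives w))

    φ : Fin p → Fin n
    φ = elements S ∘ Inverse.from (_≅_.bijection iso) ∘ index

    v~v : ∀ i j → i ≢ j → Adj G (φ (v i)) (φ (v j))
    v~v i j i≢j = subst T
      (trans (≡.sym (cong₂ (adj (augment E F)) (proj₂ (elements-surjective (survives (v i))))
                                              (proj₂ (elements-surjective (survives (v j))))))
             (≅-induced G S iso (index (v i)) (index (v j))))
      (common-neighbours E F cliques u (dominates⇒full E F dom _) (dominates⇒full E F dom _)
        (i≢j ∘ Finₚ.inject≤-injective _ _ i j))

  kept-∉ : SunFree G → n ≤ 8 → (E : Fin p → Fin q → Bool) (F : Graph q) → Admissible E F →
           ¬ G [ S ] ≅ augment E F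
  kept-∉ {p} sunFree n≤8 E F (nonTU , cliques) iso with minimallyNonTU⇒square (biadjacency E) nonTU
  ... | refl = sunFree⇒¬hasSun sunFree
    (sparse⇒hasSun p<5 E (k₄-free⇒sparse k₄-free) (minimallyNonTU⇒det (biadjacency E) nonTU))
    where
    open _≅_ iso using (bijection)
    open Embedding {G = G} {E = E} {F} cliques (elements S ∘ Inverse.from bijection)
      (Injection.injective (↔⇒↣ (↔-sym bijection)) ∘ elements-injective S) (≅-induced G S iso)

    p<5 : p < 5
    -- Squareness gives `p + p` vertices, so `5 ≤ p` would put ten vertices into `S`.
    p<5 = ℕₚ.≰⇒> λ 5≤p → from-no (10 ℕ.≤? 8) (begin
      10     ≤⟨ ℕₚ.+-mono-≤ 5≤p 5≤p ⟩
      p + p  ≡⟨ ↔⇒≡ bijection ⟨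
      ∣ S ∣  ≤⟨ ∣p∣≤n S ⟩
      n      ≤⟨ n≤8 ⟩
      8      ∎)
      where open ℕₚ.≤-Reasoning

induced-∉ℛ : (S : Subset 8) → ¬ ℛ (Gᵛ [ S ])
induced-∉ℛ S (deleted E F adm u dom iso) = deleted-∉ Gᵛ k₄-free S E F adm u dom iso
induced-∉ℛ S (kept E F adm _ iso)        = kept-∉ Gᵛ k₄-free S sunFree ℕₚ.≤-refl E F adm iso

-- Linear programming duality and integrality

<⇒≱ : ∀ {r s} → r ℚ.< s → ¬ s ℚ.≤ r
<⇒≱ r<s s≤r = ℚₚ.<-irrefl refl (ℚₚ.<-≤-trans r<s s≤r)

∑-mono-≤ : {f g : Vector ℚ n} → f ≤ᵛ g → ∑ℚ f ℚ.≤ ∑ℚ g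
∑-mono-≤ {zero}  f≤g = ℚₚ.≤-refl
∑-mono-≤ {suc n} f≤g = ℚₚ.+-mono-≤ (f≤g zero) (∑-mono-≤ (f≤g ∘ suc))

-- One strict term would make the whole sum strict.
∑-squeeze : {f g : Vector ℚ n} → f ≤ᵛ g → ∑ℚ g ℚ.≤ ∑ℚ f → g ≤ᵛ f
∑-squeeze f≤g ∑g≤∑f zero = ℚₚ.≮⇒≥ λ f<g →
  <⇒≱ (ℚₚ.+-mono-<-≤ f<g (∑-mono-≤ (f≤g ∘ suc))) ∑g≤∑f
∑-squeeze f≤g ∑g≤∑f (suc i) = ∑-squeeze (f≤g ∘ suc)
  (ℚₚ.≮⇒≥ λ F<G → <⇒≱ (ℚₚ.+-mono-≤-< (f≤g zero) F<G) ∑g≤∑f) i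

IsInteger : ℚ → Set
IsInteger r = ∃ λ z → fromℤ z ≡ r

-- The numerator is the only candidate.
isInteger? : ∀ r → Dec (IsInteger r)
isInteger? r = map′ (ℚ.↥ r ,_) (λ { (z , refl) → refl }) (fromℤ (ℚ.↥ r) ℚ.≟ r)

+-isInteger : ∀ {r s} → IsInteger r → IsInteger s → IsInteger (r ℚ.+ s)
+-isInteger (a , refl) (b , refl) = a ℤ.+ b , ℚₚ.toℚᵘ-injective (ℚᵘₚ.≃-trans
  (ℚᵘ.*≡* (cong (ℤ._* 1ℤ) (cong₂ ℤ._+_ (≡.sym (ℤₚ.*-identityʳ a)) (≡.sym (ℤₚ.*-identityʳ b)))))
  (ℚᵘₚ.≃-sym (ℚₚ.toℚᵘ-homo-+ (fromℤ a) (fromℤ b))))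

*-isInteger : ∀ {r s} → IsInteger r → IsInteger s → IsInteger (r ℚ.* s)
*-isInteger (a , refl) (b , refl) = a ℤ.* b , ℚₚ.toℚᵘ-injective (ℚᵘₚ.≃-trans
  (ℚᵘ.*≡* refl) (ℚᵘₚ.≃-sym (ℚₚ.toℚᵘ-homo-* (fromℤ a) (fromℤ b))))

∑-isInteger : (f : Vector ℚ n) → (∀ i → IsInteger (f i)) → IsInteger (∑ℚ f)
∑-isInteger {zero}  f f∈ℤ = 0ℤ , refl
∑-isInteger {suc n} f f∈ℤ = +-isInteger (f∈ℤ zero) (∑-isInteger (f ∘ suc) (f∈ℤ ∘ suc))

module Duality (L : LinearSystem n) where
  open LinearSystem L hiding (TDI)

  -- Exchange of the two sums. Here `x` is arbitrary, as the identity is also applied to a `t` that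
  -- need not be feasible.
  dualFeasible⇒· : ∀ {w y} → DualFeasible w y → ∀ x → w · x ≡ ∑ℚ λ i → y i ℚ.* (A i · x)
  dualFeasible⇒· {w} {y} (Aᵀy≡w , _) x = begin
    (∑ℚ λ j → w j ℚ.* x j)
      ≡⟨ ℚSum.sum-cong-≗ (λ j → cong (ℚ._* x j) (≡.sym (Aᵀy≡w j))) ⟩
    (∑ℚ λ j → (∑ℚ λ i → A i j ℚ.* y i) ℚ.* x j)
      ≡⟨ ℚSum.sum-cong-≗ (λ j → ℚSum.*-distribʳ-sum (x j) (λ i → A i j ℚ.* y i)) ⟩
    (∑ℚ λ j → ∑ℚ λ i → A i j ℚ.* y i ℚ.* x j)
      ≡⟨ ℚSum.∑-comm (λ j i → A i j ℚ.* y i ℚ.* x j) ⟩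
    (∑ℚ λ i → ∑ℚ λ j → A i j ℚ.* y i ℚ.* x j)
      ≡⟨ ℚSum.sum-cong-≗ (λ i → ℚSum.sum-cong-≗ λ j →
           trans (cong (ℚ._* x j) (ℚₚ.*-comm (A i j) (y i))) (ℚₚ.*-assoc (y i) (A i j) (x j))) ⟩
    (∑ℚ λ i → ∑ℚ λ j → y i ℚ.* (A i j ℚ.* x j))
      ≡⟨ ℚSum.sum-cong-≗ (λ i → ℚSum.*-distribˡ-sum (y i) (λ j → A i j ℚ.* x j)) ⟨
    (∑ℚ λ i → y i ℚ.* (A i · x)) ∎
    where open ≡.≡-Reasoning

  b·-comm : ∀ y → b · y ≡ ∑ℚ λ i → y i ℚ.* b i
  b·-comm y = ℚSum.sum-cong-≗ λ i → ℚₚ.*-comm (b i) (y i)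

  weighted-≤ : ∀ {x w y} → Feasible x → DualFeasible w y →
               (λ i → y i ℚ.* (A i · x)) ≤ᵛ (λ i → y i ℚ.* b i)
  weighted-≤ {y = y} Ax≤b (_ , 0≤y) i = ℚₚ.*-monoˡ-≤-nonNeg (y i) {{ℚ.nonNegative (0≤y i)}} (Ax≤b i)

  weakDuality : ∀ {x w y} → Feasible x → DualFeasible w y → w · x ℚ.≤ b · y
  weakDuality {x} {w} {y} Ax≤b dual = ≡.subst₂ ℚ._≤_
    (≡.sym (dualFeasible⇒· dual x)) (≡.sym (b·-comm y)) (∑-mono-≤ (weighted-≤ Ax≤b dual))

  -- Equal objective values force equality in every term of weak duality; a positive `y i` could be
  -- cancelled from its term, making row `i` tight.
  complementarySlackness : ∀ {x w y} → Feasible x → DualFeasible w y → b · y ℚ.≤ w · x →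
                           ∀ i → A i · x ℚ.< b i → y i ≡ 0ℚ
  complementarySlackness {x} {w} {y} Ax≤b dual b·y≤w·x i Ax<b = ℚₚ.≤-antisym
    (ℚₚ.≮⇒≥ λ 0<y → <⇒≱ Ax<b (ℚₚ.*-cancelˡ-≤-pos (y i) {{ℚ.positive 0<y}}
      (∑-squeeze (weighted-≤ Ax≤b dual)
        (≡.subst₂ ℚ._≤_ (b·-comm y) (dualFeasible⇒· dual x) b·y≤w·x) i)))
    (proj₂ dual i)

  -- An integral dual optimum y is supported on the rows tight at x, so w · t = ∑ yᵢ (Aᵢ · t)
  -- would be an integer.
  fractional⇒¬TDI : (w : Vector ℤ n) (x t : Vector ℚ n) (y : Vector ℚ rows) →
    Feasible x → DualFeasible (fromℤ ∘ w) y → b · y ≡ (fromℤ ∘ w) · x →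
    (∀ i → A i · x ℚ.< b i ⊎ IsInteger (A i · t)) → ¬ IsInteger ((fromℤ ∘ w) · t) → ¬ TDI L
  fractional⇒¬TDI w x t y Ax≤b dual optimal tight∈ℤ w·t∉ℤ tdi
    -- `x` and `y` have equal values, so weak duality makes both optimal.
    with tdi w _ ((x , Ax≤b , refl) , λ x′ Ax′≤b → subst (_ ℚ.≤_) optimal (weakDuality Ax′≤b dual))
                 ((y , dual , optimal) , λ y′ dual′ → weakDuality Ax≤b dual′)
  ... | y′ , dual′ , optimal′ = w·t∉ℤ (subst IsInteger (≡.sym (dualFeasible⇒· dual′ t))
    (∑-isInteger _ λ i → term i (tight∈ℤ i)))
    where
    term : ∀ i → A i · x ℚ.< b i ⊎ IsInteger (A i · t) → IsInteger (fromℤ (y′ i) ℚ.* (A i · t))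
    -- A slack row has multiplier 0, whatever the value of `A i · t`.
    term i (inj₁ Ax<b)  = 0ℤ , ≡.sym (trans
      (cong (ℚ._* (A i · t)) (complementarySlackness Ax≤b dual′ (ℚₚ.≤-reflexive optimal′) i Ax<b))
      (ℚₚ.*-zeroˡ (A i · t)))
    term i (inj₂ A·t∈ℤ) = *-isInteger (y′ i , refl) A·t∈ℤ

-- The box system of Gᵛ

listSystem : List (Subset n) → LinearSystem n
listSystem {n} Cs = record
  { A = VF.map incidence (VF.fromList Cs) VF.++ -identity n
  ; b = VF.replicate (length Cs) 1ℚ VF.++ VF.replicate n 0ℚ
  }

cliqueSystem≡listSystem : (G : Graph n) → cliqueSystem G ≡ listSystem (cliques G)
cliqueSystem≡listSystem G = refl

-- With the list as a parameter, the computed cliques are exchanged for the explicit ones in matrix,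
-- right-hand side and row count at once.
cliqueSystem-Gᵛ : cliqueSystem Gᵛ ≡ listSystem cliqueList
cliqueSystem-Gᵛ = trans (cliqueSystem≡listSystem Gᵛ) (cong listSystem cliques-Gᵛ)

¼ ¾ : ℚ
¼ = ½ ℚ.* ½
¾ = ½ ℚ.+ ¼

-- x* is an average of the stable sets axy, bez, cdz, adez, which meet all of abc, bdy, cex, xz, yz.
ℓ u x* t : Vector ℚ 8
ℓ  = lookup (½ ∷ 0ℚ ∷ 0ℚ ∷ ½ ∷ ½ ∷ 0ℚ ∷ 0ℚ ∷ 0ℚ ∷ [])
u  = VF.replicate 8 1ℚ
x* = lookup (½ ∷ ¼ ∷ ¼ ∷ ½ ∷ ½ ∷ ¼ ∷ ¼ ∷ ¾ ∷ [])
t  = lookup (0ℚ ∷ ½ ∷ ½ ∷ 0ℚ ∷ 0ℚ ∷ ½ ∷ ½ ∷ ½ ∷ [])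

w : Vector ℤ 8
w = lookup (0ℤ ∷ 1ℤ ∷ 1ℤ ∷ 0ℤ ∷ 0ℤ ∷ 1ℤ ∷ 1ℤ ∷ 1ℤ ∷ [])

tightCliques : List (Subset 8)
tightCliques = (I ∷ I ∷ I ∷ O ∷ O ∷ O ∷ O ∷ O ∷ [])
             ∷ (O ∷ I ∷ O ∷ I ∷ O ∷ O ∷ I ∷ O ∷ [])
             ∷ (O ∷ O ∷ I ∷ O ∷ I ∷ I ∷ O ∷ O ∷ [])
             ∷ (O ∷ O ∷ O ∷ O ∷ O ∷ I ∷ O ∷ I ∷ [])
             ∷ (O ∷ O ∷ O ∷ O ∷ O ∷ O ∷ I ∷ I ∷ [])
             ∷ []

L* : LinearSystem 8
L* = box (listSystem cliqueList) ℓ u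

open LinearSystem L* hiding (TDI)

-- The final ℓ happens to be the multiplier vector ½ at a, d, e of the lower bounds.
y* : Vector ℚ rows
y* = (VF.map (λ C → if does (C ∈ᴸ? tightCliques) then ½ else 0ℚ) (VF.fromList cliqueList)
       VF.++ VF.replicate 8 0ℚ) VF.++ VF.replicate 8 0ℚ VF.++ ℓ

abstract
  x*-feasible : Feasible x*
  x*-feasible = from-yes (all? λ i → A i · x* ℚ.≤? b i)

  -- Each of b, c, x, y, z lies in two of the tight cliques, giving ½ + ½ = 1. Each of a, d, e lies
  -- in one, and its ½ is cancelled by the lower bound.
  y*-dualFeasible : DualFeasible (fromℤ ∘ w) y*
  y*-dualFeasible = from-yes ((all? λ j → (λ i → A i j) · y* ℚ.≟ fromℤ (w j)) ×-dec all? λ i → 0ℚ ℚ.≤? y* i)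

  optimal : b · y* ≡ (fromℤ ∘ w) · x*
  optimal = refl

  -- `t` is ½ on the odd cycle. The tight rows are the five cliques, each with two cycle vertices
  -- and hence value 1, and the lower bounds at a, d, e, where `t` vanishes. In contrast, `w` takes
  -- the value 5/2 on `t`.
  tight∈ℤ : ∀ i → A i · x* ℚ.< b i ⊎ IsInteger (A i · t)
  tight∈ℤ = from-yes (all? λ i → (A i · x* ℚ.<? b i) ⊎-dec isInteger? (A i · t))

  w·t∉ℤ : ¬ IsInteger ((fromℤ ∘ w) · t)
  w·t∉ℤ = from-no (isInteger? ((fromℤ ∘ w) · t))

¬TDI-L* : ¬ TDI L*
¬TDI-L* = Duality.fractional⇒¬TDI L* w x* t y*
  x*-feasible y*-dualFeasible optimal tight∈ℤ w·t∉ℤ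

¬boxPerfect-Gᵛ : ¬ BoxPerfect Gᵛ
¬boxPerfect-Gᵛ boxTDI = ¬TDI-L* (subst BoxTDI cliqueSystem-Gᵛ boxTDI ℓ u)

proposition6p5 : Perfect Gᵛ × ¬ BoxPerfect Gᵛ × (∀ (S : Subset 8) → ¬ ℛ (Gᵛ [ S ]))
proposition6p5 = perfect-Gᵛ , ¬boxPerfect-Gᵛ , induced-∉ℛ
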